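{- Let $W$ be a weighing matrix $W(23,16)$. Then $\widetilde\Gamma(W)$ is a regular weighted graph of degree $10$; that is, for every vertex $i\in\{1,\ldots,23\}$, the sum of the weights of all edges of $\widetilde\Gamma(W)$ incident to $i$ equals $10$.
   Context: A weighing matrix $W(n,k)$ is an $n\times n$ matrix $W$ with entries in $\{0,1,-1\}$ whose rows are pairwise orthogonal and have length $\sqrt{k}$, i.e. $WW^T=kI_n$. For a weighing matrix $W$ of type $W(23,16)$ and $i\in\{1,\ldots,23\}$, let $L_i\subseteq\{1,\ldots,23\}$ (the $i$-th "line") be the set of column positions at which the $i$-th row of $W$ is zero. The weighted graph $\widetilde\Gamma(W)$ has vertex set $\{1,2,\ldots,23\}$, and distinct vertices $i$ and $j$ are joined by an edge of weight $1$, $2$, $3$ if $|L_i\cap L_j|=3,5,7$ respectively (and are not joined otherwise); there are no loops. -}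

module Defs where

open import Algebra.Properties.Semiring.Sum using (sum)
open import Data.Bool using (if_then_else_)
open import Data.Fin using (Fin; _≟_)
open import Data.Fin.Subset using (Subset; ∣_∣; _∩_)
open import Data.Fin.Subset.Properties using (∩-comm)
open import Data.Integer as ℤ using (ℤ; +_; 0ℤ; 1ℤ; -1ℤ)
import Data.Integer.Properties as ℤ
open import Data.Nat using (ℕ)
import Data.Nat.Properties as ℕ
open import Data.Sum using (_⊎_)
open import Data.Vec using (tabulate)
open import Data.Vec.Functional using (Vector; transpose)
open import Relation.Binary.PropositionalEquality using (_≡_; refl; sym; cong)
open import Relation.Nullary using (does; yes; no; contradiction)

Matrix : ℕ → Set
Matrix n = Vector (Vector ℤ n) n

_⊗_ : ∀ {n} → Matrix n → Matrix n → Matrix n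
(A ⊗ B) i j = sum ℤ.+-*-semiring (λ l → A i l ℤ.* B l j)

𝕀 : ∀ {n} → Matrix n
𝕀 i j = if does (i ≟ j) then 1ℤ else 0ℤ

record IsWeighingMatrix (n k : ℕ) (W : Matrix n) : Set where
  field
    entries : ∀ i j → W i j ≡ 0ℤ ⊎ W i j ≡ 1ℤ ⊎ W i j ≡ -1ℤ
    WWᵀ≡kI  : ∀ i j → (W ⊗ transpose W) i j ≡ + k ℤ.* 𝕀 i j

-- The weight 0 encodes that two vertices are not joined.
record WeightedGraph (n : ℕ) : Set where
  field
    weight    : Fin n → Fin n → ℕ
    symmetric : ∀ i j → weight i j ≡ weight j i
    loopless  : ∀ i → weight i i ≡ 0

degree : ∀ {n} → WeightedGraph n → Fin n → ℕ
degree G i = sum ℕ.+-*-semiring (WeightedGraph.weight G i)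

IsRegular : ∀ {n} → WeightedGraph n → ℕ → Set
IsRegular G d = ∀ i → degree G i ≡ d

line : ∀ {n} → Matrix n → Fin n → Subset n
line W i = tabulate (λ j → does (W i j ℤ.≟ 0ℤ))

edgeWeight : ℕ → ℕ
edgeWeight 3 = 1
edgeWeight 5 = 2
edgeWeight 7 = 3
edgeWeight _ = 0

Γ̃ : Matrix 23 → WeightedGraph 23
Γ̃ W = record { weight = w ; symmetric = w-sym ; loopless = w-diag }
  where
  w : Fin 23 → Fin 23 → ℕ
  w i j = if does (i ≟ j) then 0 else edgeWeight ∣ line W i ∩ line W j ∣

  w-sym : ∀ i j → w i j ≡ w j i
  w-sym i j with i ≟ j | j ≟ i
  ... | yes _ | yes _ = refl
  ... | yes p | no ¬q = contradiction (sym p) ¬q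
  ... | no ¬p | yes q = contradiction (sym q) ¬p
  ... | no _  | no _  = cong (λ s → edgeWeight ∣ s ∣) (∩-comm (line W i) (line W j))

  w-diag : ∀ i → w i i ≡ 0
  w-diag i with i ≟ i
  ... | yes _ = refl
  ... | no ¬p = contradiction refl ¬p

{-# OPTIONS --safe #-}
-- Orthogonality of rows i ≠ j forces their supports to meet in an even number of positions, so
-- |L_i ∩ L_j| = 1, 3, 5 or 7 and the weight of the edge ij is (|L_i ∩ L_j| - 1) / 2.  Hence the degree
-- of i is determined by ∑_j |L_i ∩ L_j|, and this sum is known once every column of W, like every row,
-- has exactly 16 nonzero entries.  For the columns let S be the number of nonzero entries of
-- column c and v = ∑_i W_ic row_i: then v_c = S and ‖v‖² = 16 S, so S² ≤ 16 S and S ≤ 16, and since all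
-- columns together have as many nonzero entries as all rows, equality holds throughout.
module Submission where

open import Defs
open import Algebra.Bundles using (Monoid)
import Algebra.Definitions.RawMonoid as RawMonoidSum
import Algebra.Properties.CommutativeSemigroup as CommutativeSemigroupProperties
import Algebra.Properties.Semiring.Sum as SemiringSum
open import Data.Bool using (Bool; true; false; if_then_else_)
open import Data.Fin using (Fin; zero; suc; _≟_)
open import Data.Fin.Subset using (∣_∣; _∩_)
open import Data.Fin.Subset.Properties using (∩-idem; ∣p∩q∣≤∣p∣)
open import Data.Integer as ℤ using (ℤ; +_; -[1+_]; 0ℤ; 1ℤ)
import Data.Integer.Properties as ℤ
open import Data.Nat using (ℕ; zero; suc; _+_; _*_; _≤_; _<_; s≤s; z≤n)
import Data.Nat.Properties as ℕ
open import Data.Nat.Divisibility using (_∣_; divides; _∣?_)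
open import Data.Product using (∃; _,_; proj₁; proj₂)
open import Data.Sum using (inj₁; inj₂)
open import Data.Vec using (tabulate)
open import Data.Vec.Functional using (Vector; transpose)
open import Function using (_∘_)
open import Relation.Binary.PropositionalEquality using (_≡_; _≢_; _≗_; refl; sym; trans; cong; cong₂; subst; module ≡-Reasoning)
open import Relation.Nullary using (does; yes; no)
open import Relation.Nullary.Decidable using (from-yes; dec-true; dec-false; _→-dec_)

module ℕΣ = SemiringSum ℕ.+-*-semiring
module ℤΣ = SemiringSum ℤ.+-*-semiring
module ℤ* = CommutativeSemigroupProperties ℤ.*-commutativeSemigroup

private variable
  n k : ℕ

-- Finite sums

module _ {c ℓ} (M : Monoid c ℓ) where
  open Monoid M renaming (refl to ≈-refl; trans to ≈-trans)
  open RawMonoidSum rawMonoid using () renaming (sum to ∑)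

  sum-zero : ∀ n → ∑ {n} (λ _ → ε) ≈ ε
  sum-zero zero    = ≈-refl
  sum-zero (suc n) = ≈-trans (identityˡ _) (sum-zero n)

  sum-select : ∀ (f : Vector Carrier n) i → ∑ (λ j → if does (i ≟ j) then f j else ε) ≈ f i
  sum-select {n = suc n} f zero    = ≈-trans (∙-congˡ (sum-zero n)) (identityʳ _)
  sum-select {n = suc n} f (suc i) = ≈-trans (identityˡ _) (sum-select (f ∘ suc) i)

sum-const : ∀ n k → ℕΣ.sum {n} (λ _ → k) ≡ n * k
sum-const zero    k = refl
sum-const (suc n) k = cong (_+_ k) (sum-const n k)

sum-mono-≤ : {f g : Vector ℕ n} → (∀ i → f i ≤ g i) → ℕΣ.sum f ≤ ℕΣ.sum g
sum-mono-≤ {n = zero}  f≤g = z≤n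
sum-mono-≤ {n = suc n} f≤g = ℕ.+-mono-≤ (f≤g zero) (sum-mono-≤ (f≤g ∘ suc))

term≤sum : (f : Vector ℕ n) → ∀ i → f i ≤ ℕΣ.sum f
term≤sum f zero    = ℕ.m≤m+n _ _
term≤sum f (suc i) = ℕ.≤-trans (term≤sum (f ∘ suc) i) (ℕ.m≤n+m _ _)

-- Raising the head of `f` to that of `g` can only increase the sum. Cancelling `g zero` bounds the
-- tail sum of `g` by that of `f`, so the tail sums agree, and then so do the heads.
≤∧sum≡⇒≡ : {f g : Vector ℕ n} → (∀ i → f i ≤ g i) → ℕΣ.sum f ≡ ℕΣ.sum g → f ≗ g
≤∧sum≡⇒≡ {n = suc n} {f} {g} f≤g eq = λ { zero → heads ; (suc i) → ≤∧sum≡⇒≡ (f≤g ∘ suc) tails i }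
  where
  tails : ℕΣ.sum (f ∘ suc) ≡ ℕΣ.sum (g ∘ suc)
  tails = ℕ.≤-antisym (sum-mono-≤ (f≤g ∘ suc))
    (ℕ.+-cancelˡ-≤ (g zero) _ _
      (ℕ.≤-trans (ℕ.≤-reflexive (sym eq)) (ℕ.+-monoˡ-≤ _ (f≤g zero))))
  heads : f zero ≡ g zero
  heads = ℕ.+-cancelʳ-≡ _ _ _ (trans eq (cong (_+_ (g zero)) (sym tails)))

-- Absolute values and parity of integer sums

pos-sum : (f : Vector ℕ n) → + ℕΣ.sum f ≡ ℤΣ.sum (+_ ∘ f)
pos-sum {n = zero}  f = refl
pos-sum {n = suc n} f = cong (λ i → + f zero ℤ.+ i) (pos-sum (f ∘ suc))

i*i≡+∣i∣*∣i∣ : ∀ i → i ℤ.* i ≡ + (ℤ.∣ i ∣ * ℤ.∣ i ∣)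
i*i≡+∣i∣*∣i∣ (+ n)    = sym (ℤ.pos-* n n)
i*i≡+∣i∣*∣i∣ -[1+ n ] = refl

-- This is the congruence of an integer and its absolute value modulo 2. The witness is 0 or
-- `∣ i ∣`; being natural, it can be summed in `ℕ`.
∣i∣≡i+2q : ∀ i → ∃ λ q → + ℤ.∣ i ∣ ≡ i ℤ.+ + 2 ℤ.* + q
∣i∣≡i+2q (+ n)    = 0 , sym (ℤ.+-identityʳ (+ n))
∣i∣≡i+2q -[1+ n ] = suc n , (begin
  + suc n                                            ≡⟨ ℤ.+-identityˡ (+ suc n) ⟨
  0ℤ ℤ.+ + suc n                                     ≡⟨ cong (λ i → i ℤ.+ + suc n) (ℤ.+-inverseˡ (+ suc n)) ⟨
  -[1+ n ] ℤ.+ + suc n ℤ.+ + suc n                   ≡⟨ ℤ.+-assoc -[1+ n ] (+ suc n) (+ suc n) ⟩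
  -[1+ n ] ℤ.+ (+ suc n ℤ.+ + suc n)                 ≡⟨ cong (λ m → -[1+ n ] ℤ.+ + (suc n + m)) (ℕ.+-identityʳ (suc n)) ⟨
  -[1+ n ] ℤ.+ + (2 * suc n)                         ≡⟨ cong (λ i → -[1+ n ] ℤ.+ i) (ℤ.pos-* 2 (suc n)) ⟩
  -[1+ n ] ℤ.+ + 2 ℤ.* + suc n                       ∎)
  where open ≡-Reasoning

-- Passing to absolute values changes each term, hence the whole sum, by an even number.
sum≡0⇒2∣sum∣∣ : (f : Vector ℤ n) → ℤΣ.sum f ≡ 0ℤ → 2 ∣ ℕΣ.sum (λ i → ℤ.∣ f i ∣)
sum≡0⇒2∣sum∣∣ f ∑f≡0 = divides (ℕΣ.sum q) (ℤ.+-injective (begin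
  + ℕΣ.sum (λ i → ℤ.∣ f i ∣)                  ≡⟨ pos-sum (λ i → ℤ.∣ f i ∣) ⟩
  ℤΣ.sum (λ i → + ℤ.∣ f i ∣)                  ≡⟨ ℤΣ.sum-cong-≗ (λ i → proj₂ (∣i∣≡i+2q (f i))) ⟩
  ℤΣ.sum (λ i → f i ℤ.+ + 2 ℤ.* + q i)        ≡⟨ ℤΣ.∑-distrib-+ f _ ⟩
  ℤΣ.sum f ℤ.+ ℤΣ.sum (λ i → + 2 ℤ.* + q i)   ≡⟨ cong₂ ℤ._+_ ∑f≡0 (sym (ℤΣ.*-distribˡ-sum (+ 2) (+_ ∘ q))) ⟩
  0ℤ ℤ.+ + 2 ℤ.* ℤΣ.sum (+_ ∘ q)              ≡⟨ ℤ.+-identityˡ _ ⟩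
  + 2 ℤ.* ℤΣ.sum (+_ ∘ q)                     ≡⟨ cong (+ 2 ℤ.*_) (pos-sum q) ⟨
  + 2 ℤ.* + ℕΣ.sum q                          ≡⟨ ℤ.pos-* 2 (ℕΣ.sum q) ⟨
  + (2 * ℕΣ.sum q)                            ≡⟨ cong +_ (ℕ.*-comm 2 (ℕΣ.sum q)) ⟩
  + (ℕΣ.sum q * 2)                            ∎))
  where
  open ≡-Reasoning
  q = λ i → proj₁ (∣i∣≡i+2q (f i))

-- Counting with 0/1 indicators

𝟙 : Bool → ℕ
𝟙 b = if b then 1 else 0

∣tabulate∩tabulate∣ : (f g : Vector Bool n) →
  ∣ tabulate f ∩ tabulate g ∣ ≡ ℕΣ.sum (λ i → 𝟙 (f i) * 𝟙 (g i))
∣tabulate∩tabulate∣ {n = zero}  f g = refl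
∣tabulate∩tabulate∣ {n = suc n} f g with f zero | g zero
... | true  | true  = cong suc (∣tabulate∩tabulate∣ (f ∘ suc) (g ∘ suc))
... | true  | false = ∣tabulate∩tabulate∣ (f ∘ suc) (g ∘ suc)
... | false | true  = ∣tabulate∩tabulate∣ (f ∘ suc) (g ∘ suc)
... | false | false = ∣tabulate∩tabulate∣ (f ∘ suc) (g ∘ suc)

-- This is `(1 - x)(1 - y) + x + y = 1 + xy`, written without subtraction; the indicators are the
-- complements of `x` and `y`.
inclusion-exclusion : ∀ b c {x y} → 𝟙 b + x ≡ 1 → 𝟙 c + y ≡ 1 → 𝟙 b * 𝟙 c + (x + y) ≡ 1 + x * y
inclusion-exclusion true  true  {zero} {zero} _ _ = refl
inclusion-exclusion true  false {zero} {_}    _ p = p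
inclusion-exclusion false true  {_} {zero} refl _ = refl
inclusion-exclusion false false refl refl = refl

-- Weighing matrices of arbitrary order and weight

module WeighingMatrix (W : Matrix n) (isW : IsWeighingMatrix n k W) where
  open IsWeighingMatrix isW

  absW : Fin n → Fin n → ℕ
  absW i j = ℤ.∣ W i j ∣

  -- As the entries are 0, 1 or -1, this counts the columns in which both rows are nonzero.
  common : Fin n → Fin n → ℕ
  common i j = ℕΣ.sum (λ l → absW i l * absW j l)

  W*W≡∣W∣ : ∀ i j → W i j ℤ.* W i j ≡ + absW i j
  W*W≡∣W∣ i j with W i j | entries i j
  ... | _ | inj₁ refl        = refl
  ... | _ | inj₂ (inj₁ refl) = refl
  ... | _ | inj₂ (inj₂ refl) = refl

  zero?+∣W∣≡1 : ∀ i j → 𝟙 (does (W i j ℤ.≟ 0ℤ)) + absW i j ≡ 1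
  zero?+∣W∣≡1 i j with W i j | entries i j
  ... | _ | inj₁ refl        = refl
  ... | _ | inj₂ (inj₁ refl) = refl
  ... | _ | inj₂ (inj₂ refl) = refl

  rowSum : ∀ i → ℕΣ.sum (absW i) ≡ k
  rowSum i = ℤ.+-injective (begin
    + ℕΣ.sum (absW i)                  ≡⟨ pos-sum (absW i) ⟩
    ℤΣ.sum (λ l → + absW i l)          ≡⟨ ℤΣ.sum-cong-≗ (W*W≡∣W∣ i) ⟨
    ℤΣ.sum (λ l → W i l ℤ.* W i l)     ≡⟨ WWᵀ≡kI i i ⟩
    + k ℤ.* 𝕀 i i                      ≡⟨ cong (λ b → + k ℤ.* (if b then 1ℤ else 0ℤ)) (dec-true (i ≟ i) refl) ⟩
    + k ℤ.* 1ℤ                         ≡⟨ ℤ.*-identityʳ (+ k) ⟩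
    + k                                ∎)
    where open ≡-Reasoning

  common-diag : ∀ i → common i i ≡ k
  common-diag i = trans (ℕΣ.sum-cong-≗ idem) (rowSum i)
    where
    idem : ∀ l → absW i l * absW i l ≡ absW i l
    idem l = ℤ.+-injective (trans (sym (i*i≡+∣i∣*∣i∣ (W i l))) (W*W≡∣W∣ i l))

  -- The terms of the inner product of two distinct rows sum to 0, and their absolute values are the
  -- terms of `common i j`.
  common-even : ∀ {i j} → i ≢ j → 2 ∣ common i j
  common-even {i} {j} i≢j = subst (2 ∣_) (ℕΣ.sum-cong-≗ (λ l → ℤ.abs-* (W i l) (W j l)))
    (sum≡0⇒2∣sum∣∣ (λ l → W i l ℤ.* W j l) orthogonal)
    where
    orthogonal : ℤΣ.sum (λ l → W i l ℤ.* W j l) ≡ 0ℤ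
    orthogonal = trans (WWᵀ≡kI i j)
      (trans (cong (λ b → + k ℤ.* (if b then 1ℤ else 0ℤ)) (dec-false (i ≟ j) i≢j)) (ℤ.*-zeroʳ (+ k)))

  -- Row `c` is the combination of the rows of `W` with the entries of column `c` as coefficients.
  gram : Matrix n
  gram = transpose W ⊗ W

  -- After the sums are interchanged, the inner sum is `W j c` times the inner product of rows `i`
  -- and `j`, so only `j = i` survives.
  W⊗gram : ∀ i c → ℤΣ.sum (λ l → W i l ℤ.* gram c l) ≡ + k ℤ.* W i c
  W⊗gram i c = begin
    ℤΣ.sum (λ l → W i l ℤ.* gram c l)
      ≡⟨ ℤΣ.sum-cong-≗ (λ l → ℤΣ.*-distribˡ-sum (W i l) (λ j → W j c ℤ.* W j l)) ⟩
    ℤΣ.sum (λ l → ℤΣ.sum (λ j → W i l ℤ.* (W j c ℤ.* W j l)))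
      ≡⟨ ℤΣ.∑-comm (λ l j → W i l ℤ.* (W j c ℤ.* W j l)) ⟩
    ℤΣ.sum (λ j → ℤΣ.sum (λ l → W i l ℤ.* (W j c ℤ.* W j l)))
      ≡⟨ ℤΣ.sum-cong-≗ inner ⟩
    ℤΣ.sum (λ j → if does (i ≟ j) then + k ℤ.* W j c else 0ℤ)
      ≡⟨ sum-select ℤ.+-0-monoid (λ j → + k ℤ.* W j c) i ⟩
    + k ℤ.* W i c ∎
    where
    open ≡-Reasoning
    scale : ∀ b x → x ℤ.* (+ k ℤ.* (if b then 1ℤ else 0ℤ)) ≡ (if b then + k ℤ.* x else 0ℤ)
    scale true  x = trans (cong (x ℤ.*_) (ℤ.*-identityʳ (+ k))) (ℤ.*-comm x (+ k))
    scale false x = trans (cong (x ℤ.*_) (ℤ.*-zeroʳ (+ k))) (ℤ.*-zeroʳ x)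
    inner : ∀ j → ℤΣ.sum (λ l → W i l ℤ.* (W j c ℤ.* W j l)) ≡ (if does (i ≟ j) then + k ℤ.* W j c else 0ℤ)
    inner j = begin
      ℤΣ.sum (λ l → W i l ℤ.* (W j c ℤ.* W j l))
        ≡⟨ ℤΣ.sum-cong-≗ (λ l → ℤ*.x∙yz≈y∙xz (W i l) (W j c) (W j l)) ⟩
      ℤΣ.sum (λ l → W j c ℤ.* (W i l ℤ.* W j l))
        ≡⟨ ℤΣ.*-distribˡ-sum (W j c) (λ l → W i l ℤ.* W j l) ⟨
      W j c ℤ.* ℤΣ.sum (λ l → W i l ℤ.* W j l)
        ≡⟨ cong (W j c ℤ.*_) (WWᵀ≡kI i j) ⟩
      W j c ℤ.* (+ k ℤ.* 𝕀 i j)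
        ≡⟨ scale (does (i ≟ j)) (W j c) ⟩
      (if does (i ≟ j) then + k ℤ.* W j c else 0ℤ) ∎

  gram-diag : ∀ c → gram c c ≡ + ℕΣ.sum (λ i → absW i c)
  gram-diag c = trans (ℤΣ.sum-cong-≗ (λ i → W*W≡∣W∣ i c)) (sym (pos-sum (λ i → absW i c)))

  -- Expanding one factor `gram c l` over the rows of `W` leaves the inner products computed in
  -- `W⊗gram`.
  gram² : ∀ c → ℤΣ.sum (λ l → gram c l ℤ.* gram c l) ≡ + k ℤ.* gram c c
  gram² c = begin
    ℤΣ.sum (λ l → gram c l ℤ.* gram c l)
      ≡⟨ ℤΣ.sum-cong-≗ (λ l → ℤΣ.*-distribʳ-sum (gram c l) (λ i → W i c ℤ.* W i l)) ⟩
    ℤΣ.sum (λ l → ℤΣ.sum (λ i → W i c ℤ.* W i l ℤ.* gram c l))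
      ≡⟨ ℤΣ.∑-comm (λ l i → W i c ℤ.* W i l ℤ.* gram c l) ⟩
    ℤΣ.sum (λ i → ℤΣ.sum (λ l → W i c ℤ.* W i l ℤ.* gram c l))
      ≡⟨ ℤΣ.sum-cong-≗ inner ⟩
    ℤΣ.sum (λ i → + k ℤ.* (W i c ℤ.* W i c))
      ≡⟨ ℤΣ.*-distribˡ-sum (+ k) (λ i → W i c ℤ.* W i c) ⟨
    + k ℤ.* gram c c ∎
    where
    open ≡-Reasoning
    inner : ∀ i → ℤΣ.sum (λ l → W i c ℤ.* W i l ℤ.* gram c l) ≡ + k ℤ.* (W i c ℤ.* W i c)
    inner i = begin
      ℤΣ.sum (λ l → W i c ℤ.* W i l ℤ.* gram c l)
        ≡⟨ ℤΣ.sum-cong-≗ (λ l → ℤ.*-assoc (W i c) (W i l) (gram c l)) ⟩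
      ℤΣ.sum (λ l → W i c ℤ.* (W i l ℤ.* gram c l))
        ≡⟨ ℤΣ.*-distribˡ-sum (W i c) (λ l → W i l ℤ.* gram c l) ⟨
      W i c ℤ.* ℤΣ.sum (λ l → W i l ℤ.* gram c l)
        ≡⟨ cong (W i c ℤ.*_) (W⊗gram i c) ⟩
      W i c ℤ.* (+ k ℤ.* W i c)
        ≡⟨ ℤ*.x∙yz≈y∙xz (W i c) (+ k) (W i c) ⟩
      + k ℤ.* (W i c ℤ.* W i c) ∎

  columnSum-≤ : ∀ c → ℕΣ.sum (λ i → absW i c) ≤ k
  columnSum-≤ c = cancel (ℕΣ.sum (λ i → absW i c)) (begin
    S * S                                     ≡⟨ cong (λ x → ℤ.∣ x ∣ * ℤ.∣ x ∣) (gram-diag c) ⟨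
    -- The diagonal entry alone contributes `S * S` to the squared norm of row `c` of `gram`.
    ℤ.∣ gram c c ∣ * ℤ.∣ gram c c ∣           ≤⟨ term≤sum (λ l → ℤ.∣ gram c l ∣ * ℤ.∣ gram c l ∣) c ⟩
    ℕΣ.sum (λ l → ℤ.∣ gram c l ∣ * ℤ.∣ gram c l ∣) ≡⟨ ℤ.+-injective norm ⟩
    k * S                                     ∎)
    where
    S = ℕΣ.sum (λ i → absW i c)
    norm : + ℕΣ.sum (λ l → ℤ.∣ gram c l ∣ * ℤ.∣ gram c l ∣) ≡ + (k * S)
    norm = begin
      + ℕΣ.sum (λ l → ℤ.∣ gram c l ∣ * ℤ.∣ gram c l ∣)     ≡⟨ pos-sum (λ l → ℤ.∣ gram c l ∣ * ℤ.∣ gram c l ∣) ⟩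
      ℤΣ.sum (λ l → + (ℤ.∣ gram c l ∣ * ℤ.∣ gram c l ∣))   ≡⟨ ℤΣ.sum-cong-≗ (λ l → i*i≡+∣i∣*∣i∣ (gram c l)) ⟨
      ℤΣ.sum (λ l → gram c l ℤ.* gram c l)                 ≡⟨ gram² c ⟩
      + k ℤ.* gram c c                                     ≡⟨ cong (+ k ℤ.*_) (gram-diag c) ⟩
      + k ℤ.* + S                                          ≡⟨ ℤ.pos-* k S ⟨
      + (k * S)                                            ∎
      where open ≡-Reasoning
    -- A zero column is not excluded yet, so 0 is treated apart before cancelling.
    cancel : ∀ m → m * m ≤ k * m → m ≤ k
    cancel zero    _ = z≤n
    cancel (suc m) p = ℕ.*-cancelʳ-≤ (suc m) k (suc m) p
    open ℕ.≤-Reasoning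

  columnSum : ∀ c → ℕΣ.sum (λ i → absW i c) ≡ k
  columnSum = ≤∧sum≡⇒≡ columnSum-≤
    -- Since `W` is square, the `n` column sums have the same total as `n` copies of `k`.
    (trans (ℕΣ.∑-comm (λ c i → absW i c)) (ℕΣ.sum-cong-≗ rowSum))

  -- Double counting: each of the `k` columns in which row `i` is nonzero has `k` nonzero entries.
  sum-common : ∀ i → ℕΣ.sum (common i) ≡ k * k
  sum-common i = begin
    ℕΣ.sum (common i)                                      ≡⟨ ℕΣ.∑-comm (λ j l → absW i l * absW j l) ⟩
    ℕΣ.sum (λ l → ℕΣ.sum (λ j → absW i l * absW j l))       ≡⟨ ℕΣ.sum-cong-≗ (λ l → sym (ℕΣ.*-distribˡ-sum (absW i l) (λ j → absW j l))) ⟩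
    ℕΣ.sum (λ l → absW i l * ℕΣ.sum (λ j → absW j l))       ≡⟨ ℕΣ.sum-cong-≗ (λ l → cong (absW i l *_) (columnSum l)) ⟩
    ℕΣ.sum (λ l → absW i l * k)                             ≡⟨ ℕΣ.*-distribʳ-sum k (absW i) ⟨
    ℕΣ.sum (absW i) * k                                     ≡⟨ cong (_* k) (rowSum i) ⟩
    k * k                                                   ∎
    where open ≡-Reasoning

  -- Inclusion-exclusion for the supports of the two rows, each of size `k`, summed column by
  -- column.
  ∣L∩L∣+2k≡n+common : ∀ i j → ∣ line W i ∩ line W j ∣ + (k + k) ≡ n + common i j
  ∣L∩L∣+2k≡n+common i j = begin
    ∣ line W i ∩ line W j ∣ + (k + k)
      ≡⟨ cong₂ _+_ (∣tabulate∩tabulate∣ (z i) (z j)) (sym (cong₂ _+_ (rowSum i) (rowSum j))) ⟩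
    ℕΣ.sum (λ l → 𝟙 (z i l) * 𝟙 (z j l)) + (ℕΣ.sum (absW i) + ℕΣ.sum (absW j))
      ≡⟨ cong (_+_ _) (ℕΣ.∑-distrib-+ (absW i) (absW j)) ⟨
    ℕΣ.sum (λ l → 𝟙 (z i l) * 𝟙 (z j l)) + ℕΣ.sum (λ l → absW i l + absW j l)
      ≡⟨ ℕΣ.∑-distrib-+ (λ l → 𝟙 (z i l) * 𝟙 (z j l)) (λ l → absW i l + absW j l) ⟨
    ℕΣ.sum (λ l → 𝟙 (z i l) * 𝟙 (z j l) + (absW i l + absW j l))
      ≡⟨ ℕΣ.sum-cong-≗ (λ l → inclusion-exclusion (z i l) (z j l) (zero?+∣W∣≡1 i l) (zero?+∣W∣≡1 j l)) ⟩
    ℕΣ.sum (λ l → 1 + absW i l * absW j l)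
      ≡⟨ ℕΣ.∑-distrib-+ (λ _ → 1) (λ l → absW i l * absW j l) ⟩
    ℕΣ.sum {n} (λ _ → 1) + common i j
      ≡⟨ cong (_+ common i j) (trans (sum-const n 1) (ℕ.*-identityʳ n)) ⟩
    n + common i j ∎
    where
    open ≡-Reasoning
    z : Fin n → Fin n → Bool
    z i l = does (W i l ℤ.≟ 0ℤ)

-- Order 23 and weight 16

2edgeWeight+10 : ∀ {t} → t < 8 → 2 ∣ 9 + t → 2 * edgeWeight t + 10 ≡ 9 + t
-- Divisibility leaves only odd `t`, where the weight is `(t - 1) / 2`; for `t = 1` this is the
-- default 0 of a non-edge. The eight values are checked by computation.
2edgeWeight+10 = from-yes (ℕ.allUpTo? (λ t → (2 ∣? (9 + t)) →-dec (2 * edgeWeight t + 10 ℕ.≟ 9 + t)) 8)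

module _ (W : Matrix 23) (isW : IsWeighingMatrix 23 16 W) where
  open WeighingMatrix W isW
  open WeightedGraph (Γ̃ W) using (weight)

  common≡9+∣L∩L∣ : ∀ i j → common i j ≡ 9 + ∣ line W i ∩ line W j ∣
  common≡9+∣L∩L∣ i j = ℕ.+-cancelˡ-≡ 23 _ _
    -- Here 32 is `16 + 16`, and it splits as `23 + 9` by evaluation.
    (trans (sym (∣L∩L∣+2k≡n+common i j)) (ℕ.+-comm ∣ line W i ∩ line W j ∣ 32))

  ∣L∣≡7 : ∀ i → ∣ line W i ∣ ≡ 7
  ∣L∣≡7 i = ℕ.+-cancelˡ-≡ 9 _ _ (trans (cong (λ p → 9 + ∣ p ∣) (sym (∩-idem (line W i))))
    (trans (sym (common≡9+∣L∩L∣ i i)) (common-diag i)))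

  -- The extra 6 corrects the diagonal, where the weight is 0 but `common i i` is `16 = 10 + 6`.
  2weight+10 : ∀ i j → 2 * weight i j + (10 + (if does (i ≟ j) then 6 else 0)) ≡ common i j
  2weight+10 i j with i ≟ j
  ... | yes refl = sym (common-diag i)
  ... | no i≢j   = trans (2edgeWeight+10 t<8 (subst (2 ∣_) (common≡9+∣L∩L∣ i j) (common-even i≢j)))
                         (sym (common≡9+∣L∩L∣ i j))
    where
    t<8 : ∣ line W i ∩ line W j ∣ < 8
    t<8 = s≤s (ℕ.≤-trans (∣p∩q∣≤∣p∣ (line W i) (line W j)) (ℕ.≤-reflexive (∣L∣≡7 i)))

  -- Summing `2weight+10` over `j` gives `236 = 23 * 10 + 6` as the total correction and
  -- `256 = 16 * 16` from `sum-common`.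
  2degree+236 : ∀ i → 2 * degree (Γ̃ W) i + 236 ≡ 256
  2degree+236 i = begin
    2 * degree (Γ̃ W) i + 236
      ≡⟨ cong₂ _+_ (ℕΣ.*-distribˡ-sum 2 (weight i))
           (cong (_+_ 230) (sym (sum-select ℕ.+-0-monoid (λ (_ : Fin 23) → 6) i))) ⟩
    ℕΣ.sum (λ j → 2 * weight i j) + (ℕΣ.sum {23} (λ _ → 10) + ℕΣ.sum δ)
      ≡⟨ cong (_+_ _) (ℕΣ.∑-distrib-+ (λ _ → 10) δ) ⟨
    ℕΣ.sum (λ j → 2 * weight i j) + ℕΣ.sum (λ j → 10 + δ j)
      ≡⟨ ℕΣ.∑-distrib-+ (λ j → 2 * weight i j) (λ j → 10 + δ j) ⟨
    ℕΣ.sum (λ j → 2 * weight i j + (10 + δ j))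
      ≡⟨ ℕΣ.sum-cong-≗ (2weight+10 i) ⟩
    ℕΣ.sum (common i)
      ≡⟨ sum-common i ⟩
    256 ∎
    where
    open ≡-Reasoning
    δ : Fin 23 → ℕ
    δ j = if does (i ≟ j) then 6 else 0

proposition7 : (W : Matrix 23) → IsWeighingMatrix 23 16 W → IsRegular (Γ̃ W) 10
proposition7 W isW i = ℕ.*-cancelˡ-≡ _ 10 2 (ℕ.+-cancelʳ-≡ 236 _ 20 (2degree+236 W isW i))
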